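{- Let $n\ge 1$ be an integer and let $x,y$ be complex numbers such that no denominator below vanishes, i.e. $x\notin\{ -1,\dots,-n\}$ and $y\notin\{ -n,-n+1,\dots,n-1\}$. Then $$\sum_{k=0}^n(-1)^k\binom{n}{k}\frac{\binom{y+k}{k}}{\binom{y-n+k}{k}}\frac{y}{y+k}H_{k}(x)=\frac{(-1)^n}{n}\,\frac{1}{\binom{y}{n}}\bigg\{1-\frac{\binom{x-y+n}{n}}{\binom{x+n}{n}}\bigg\}.$$
   Context: For a complex number $u$ and an integer $k\ge 0$, $\binom{u}{k}=\frac{u(u-1)\cdots(u-k+1)}{k!}$ (equal to $1$ for $k=0$). For a complex number $u$, the generalized harmonic numbers are $H_0(u)=0$ and $H_n(u)=\sum_{k=1}^n\frac{1}{u+k}$ for $n\ge1$. -}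

module Defs where

open import Algebra.Apartness.Bundles using (HeytingField; HeytingCommutativeRing)
open import Algebra.Bundles using (CommutativeRing)
open import Data.Fin.Base using (Fin; toℕ)
open import Data.Nat.Base as ℕ using (ℕ; zero; suc; NonZero; _!; _∸_; s≤s; z≤n)
import Data.Nat.Properties as ℕ
open import Data.Product.Base using (_,_; proj₁; proj₂)
open import Level using (Level)
open import Relation.Binary.PropositionalEquality.Core as ≡ using (_≡_)

private
  variable
    c ℓ₁ ℓ₂ : Level

module NatCast (F : HeytingField c ℓ₁ ℓ₂) where
  open HeytingField F
  open CommutativeRing (HeytingCommutativeRing.commutativeRing heytingCommutativeRing)
    using (semiring)
  open import Algebra.Properties.Semiring.Mult semiring using (_×_)

  ι : ℕ → Carrier
  ι n = n × 1#

CharacteristicZero : HeytingField c ℓ₁ ℓ₂ → Set ℓ₂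
CharacteristicZero F = ∀ n → .{{_ : NonZero n}} → ι n # 0#
  where open HeytingField F; open NatCast F

-- Stands in for ℂ, which is a Heyting field of characteristic zero; apartness is
-- the constructive form of ≠ under which one may divide.
module Notation (F : HeytingField c ℓ₁ ℓ₂) (char0 : CharacteristicZero F) where

  open HeytingField F
  open NatCast F public
  private
    commRing = HeytingCommutativeRing.commutativeRing heytingCommutativeRing
  open CommutativeRing commRing using (ring; semiring; +-monoid)
  open import Algebra.Apartness.Properties.HeytingCommutativeRing heytingCommutativeRing
    using (1#0; x#0y#0→xy#0; x-0≈x; #-congʳ; invertibleˡ⇒#)
  open import Algebra.Properties.Monoid.Sum +-monoid public
    using (sum-syntax; sum⁺-syntax)
  open import Algebra.Properties.Semiring.Exp semiring public using (_^_)
  open import Algebra.Properties.Semiring.Mult semiring using (×-homo-+)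
  open import Algebra.Properties.Ring ring using (-‿+-comm; -‿involutive)
  open import Relation.Binary.Reasoning.Setoid setoid

  infixl 7 _/_[_]

  -- #⇒invertible provides an inverse of b - 0#, which is also one of b.
  _/_[_] : Carrier → (b : Carrier) → b # 0# → Carrier
  a / b [ b#0 ] = a * proj₁ (#⇒invertible b#0)

  falling : Carrier → ℕ → Carrier
  falling u zero    = 1#
  falling u (suc k) = falling u k * (u - ι k)

  k!#0 : ∀ k → ι (k !) # 0#
  k!#0 k = char0 (k !) {{k ℕ.!≢0}}

  binom : Carrier → ℕ → Carrier
  binom u k = falling u k / ι (k !) [ k!#0 k ]

  H : (k : ℕ) (u : Carrier) → (∀ (j : Fin k) → u + ι (suc (toℕ j)) # 0#) → Carrier
  H k u u+j#0 = ∑[ j < k ] (1# / (u + ι (suc (toℕ j))) [ u+j#0 j ])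

  #⇒-#0 : ∀ {u v w} → w ≈ u - v → u # v → w # 0#
  #⇒-#0 {u} {v} w≈u-v u#v with #⇒invertible u#v
  ... | z , z*[u-v]≈1 , _ = #-congʳ (sym w≈u-v)
    (invertibleˡ⇒# (z , trans (*-congˡ (x-0≈x (u - v))) z*[u-v]≈1))

  inverse#0 : ∀ {b} (b#0 : b # 0#) → proj₁ (#⇒invertible b#0) # 0#
  inverse#0 {b} b#0 with #⇒invertible b#0
  ... | z , _ , [b-0]*z≈1 = invertibleˡ⇒# (b - 0# , trans (*-congˡ (x-0≈x z)) [b-0]*z≈1)

  falling#0 : ∀ u k → (∀ j → j ℕ.< k → u - ι j # 0#) → falling u k # 0#
  falling#0 u zero    _ = 1#0
  falling#0 u (suc k) h =
    x#0y#0→xy#0 (falling#0 u k (λ j j<k → h j (ℕ.m<n⇒m<1+n j<k))) (h k ℕ.≤-refl)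

  binom#0 : ∀ u k → (∀ j → j ℕ.< k → u - ι j # 0#) → binom u k # 0#
  binom#0 u k h = x#0y#0→xy#0 (falling#0 u k h) (inverse#0 (k!#0 k))

  ι-∸-+ : ∀ {k n} → k ℕ.≤ n → ι n ≈ ι (n ∸ k) + ι k
  ι-∸-+ {k} {n} k≤n = begin
    ι n               ≡⟨ ≡.cong ι (ℕ.m∸n+n≡m k≤n) ⟨
    ι (n ∸ k ℕ.+ k)   ≈⟨ ×-homo-+ 1# (n ∸ k) k ⟩
    ι (n ∸ k) + ι k   ∎

  +ι#0 : ∀ {u} k → u # - ι k → u + ι k # 0#
  +ι#0 k = #⇒-#0 (+-congˡ (sym (-‿involutive (ι k))))

  H-denominators#0 : ∀ {n k} u → (∀ j → 1 ℕ.≤ j → j ℕ.≤ n → u # - ι j) → k ℕ.≤ n →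
                     ∀ (j : Fin k) → u + ι (suc (toℕ j)) # 0#
  H-denominators#0 u h k≤n j =
    +ι#0 (suc (toℕ j)) (h _ (s≤s z≤n) (ℕ.≤-trans (toℕ<n j) k≤n))
    where open import Data.Fin.Properties using (toℕ<n)

  binom[u,n]#0 : ∀ {n} u → (∀ j → j ℕ.< n → u # ι j) → binom u n # 0#
  binom[u,n]#0 {n} u h = binom#0 u n (λ j j<n → #⇒-#0 refl (h j j<n))

  binom[u+n,n]#0 : ∀ {n} u → (∀ j → 1 ℕ.≤ j → j ℕ.≤ n → u # - ι j) →
                   binom (u + ι n) n # 0#
  binom[u+n,n]#0 {n} u h = binom#0 (u + ι n) n λ j j<n →
    #⇒-#0 (eq j (ℕ.<⇒≤ j<n)) (h (n ∸ j) (ℕ.m<n⇒0<n∸m j<n) (ℕ.m∸n≤m n j))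
    where
    eq : ∀ j → j ℕ.≤ n → u + ι n - ι j ≈ u - (- ι (n ∸ j))
    eq j j≤n = begin
      u + ι n - ι j                    ≈⟨ +-assoc u (ι n) (- ι j) ⟩
      u + (ι n - ι j)                  ≈⟨ +-congˡ (+-congʳ (ι-∸-+ j≤n)) ⟩
      u + (ι (n ∸ j) + ι j - ι j)      ≈⟨ +-congˡ (+-assoc _ _ _) ⟩
      u + (ι (n ∸ j) + (ι j - ι j))    ≈⟨ +-congˡ (+-congˡ (-‿inverseʳ (ι j))) ⟩
      u + (ι (n ∸ j) + 0#)             ≈⟨ +-congˡ (+-identityʳ _) ⟩
      u + ι (n ∸ j)                    ≈⟨ +-congˡ (-‿involutive _) ⟨
      u - (- ι (n ∸ j))                ∎

  binom[u-n+k,k]#0 : ∀ {n k} u → (∀ j → j ℕ.< n → u # ι j) → k ℕ.≤ n →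
                     binom (u - ι n + ι k) k # 0#
  binom[u-n+k,k]#0 {n} {k} u h k≤n = binom#0 (u - ι n + ι k) k λ j j<k →
    #⇒-#0 (eq j) (h (n ∸ k ℕ.+ j) (bound j<k))
    where
    bound : ∀ {j} → j ℕ.< k → n ∸ k ℕ.+ j ℕ.< n
    bound {j} j<k = ≡.subst (n ∸ k ℕ.+ j ℕ.<_) (ℕ.m∸n+n≡m k≤n) (ℕ.+-monoʳ-< (n ∸ k) j<k)

    eq : ∀ j → u - ι n + ι k - ι j ≈ u - ι (n ∸ k ℕ.+ j)
    eq j = begin
      u - ι n + ι k - ι j                        ≈⟨ +-congʳ (+-congʳ (+-congˡ (-‿cong (ι-∸-+ k≤n)))) ⟩
      u - (ι (n ∸ k) + ι k) + ι k - ι j          ≈⟨ +-congʳ (+-congʳ (+-congˡ (-‿+-comm _ _))) ⟨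
      u + (- ι (n ∸ k) - ι k) + ι k - ι j        ≈⟨ +-congʳ (+-assoc _ _ _) ⟩
      u + (- ι (n ∸ k) - ι k + ι k) - ι j        ≈⟨ +-congʳ (+-congˡ (+-assoc _ _ _)) ⟩
      u + (- ι (n ∸ k) + (- ι k + ι k)) - ι j    ≈⟨ +-congʳ (+-congˡ (+-congˡ (-‿inverseˡ _))) ⟩
      u + (- ι (n ∸ k) + 0#) - ι j               ≈⟨ +-congʳ (+-congˡ (+-identityʳ _)) ⟩
      u - ι (n ∸ k) - ι j                        ≈⟨ +-assoc _ _ _ ⟩
      u + (- ι (n ∸ k) - ι j)                    ≈⟨ +-congˡ (-‿+-comm _ _) ⟩
      u - (ι (n ∸ k) + ι j)                      ≈⟨ +-congˡ (-‿cong (×-homo-+ 1# (n ∸ k) j)) ⟨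
      u - ι (n ∸ k ℕ.+ j)                        ∎

{-# OPTIONS --safe #-}

-- Let a, b be the coefficient sequences of (1 - t)⁻ʸ and (1 - t)ʸ, and A, B those of (1 - t)⁻ʸ⁻¹
-- and (1 - t)ʸ⁻¹. Up to the factor (-1)ⁿ / binom y n, the k-th summand is a k * b (n ∸ k) * H k x,
-- and n * a k * b (n ∸ k) is y times the difference A (k - 1) * B (n ∸ k) - A k * B (n ∸ k ∸ 1).
-- Summation by parts therefore turns the left-hand side into
-- (y / n) ∑[ i < n ] A i * B (n ∸ suc i) / (x + i + 1), which is the partial fraction expansion in x
-- of the right-hand side.

module Submission where

open import Defs
open import Algebra.Apartness.Bundles using (HeytingField; HeytingCommutativeRing)
open import Algebra.Bundles using (CommutativeRing)
open import Algebra.Solver.Ring.AlmostCommutativeRing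
open import Data.Fin.Base using (toℕ; fromℕ; inject₁)
open import Data.Fin.Properties using (toℕ≤pred[n]; toℕ<n; toℕ-inject₁; toℕ-fromℕ)
open import Data.Integer.Base as ℤ using (ℤ; +_; -[1+_]; _⊖_)
import Data.Integer.Properties as ℤ
open import Data.Maybe.Base using (map)
open import Data.Nat.Base as ℕ using (ℕ; zero; suc; NonZero; _≤_; _<_; _∸_; _!; s≤s; z≤n)
import Data.Nat.Properties as ℕ
open import Data.Product.Base using (∃; _,_; proj₁; proj₂)
open import Relation.Binary.PropositionalEquality.Core as ≡ using (_≡_)
open import Relation.Nullary.Decidable using (yes; no; dec⇒maybe)
open import Relation.Nullary.Negation using (contradiction)

-- Without integer coefficients the ring solver cannot see that constants such as 1# - 1# cancel.
module IntegerCoefficients {c ℓ} (R : CommutativeRing c ℓ) where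
  open CommutativeRing R
  open import Algebra.Properties.Ring ring
  open import Algebra.Properties.Semiring.Mult.TCOptimised semiring
  open import Relation.Binary.Reasoning.Setoid setoid

  private
    -- The optimised multiple makes `⟦ + 1 ⟧` the element `1#` itself rather than `1# + 0#`, so
    -- constants in solver equations match the goals definitionally.
    ⟦_⟧ : ℤ → Carrier
    ⟦ + n ⟧      = n × 1#
    ⟦ -[1+ n ] ⟧ = - (suc n × 1#)

    ⟦⟧-⊖ : ∀ m n → ⟦ m ⊖ n ⟧ ≈ m × 1# - n × 1#
    ⟦⟧-⊖ m       zero    = sym (trans (+-congˡ -0#≈0#) (+-identityʳ _))
    ⟦⟧-⊖ zero    (suc n) = sym (+-identityˡ _)
    ⟦⟧-⊖ (suc m) (suc n) = begin
      ⟦ suc m ⊖ suc n ⟧                        ≡⟨ ≡.cong ⟦_⟧ (ℤ.[1+m]⊖[1+n]≡m⊖n m n) ⟩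
      ⟦ m ⊖ n ⟧                                ≈⟨ ⟦⟧-⊖ m n ⟩
      m × 1# - n × 1#                          ≈⟨ +-congʳ (+-identityʳ _) ⟨
      m × 1# + 0# - n × 1#                     ≈⟨ +-congʳ (+-congˡ (-‿inverseʳ 1#)) ⟨
      m × 1# + (1# - 1#) - n × 1#              ≈⟨ +-congʳ (+-assoc _ _ _) ⟨
      m × 1# + 1# - 1# - n × 1#                ≈⟨ +-assoc _ _ _ ⟩
      m × 1# + 1# + (- 1# - n × 1#)            ≈⟨ +-cong (+-comm _ _) (-‿+-comm _ _) ⟩
      1# + m × 1# - (1# + n × 1#)              ≈⟨ +-cong (1+× m 1#) (-‿cong (1+× n 1#)) ⟨
      suc m × 1# - suc n × 1#                  ∎

    ⟦⟧-neg : ∀ i → ⟦ ℤ.- i ⟧ ≈ - ⟦ i ⟧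
    ⟦⟧-neg (+ zero)   = sym -0#≈0#
    ⟦⟧-neg (+ suc n)  = refl
    ⟦⟧-neg (-[1+ n ]) = sym (-‿involutive _)

    ⟦⟧-+ : ∀ i j → ⟦ i ℤ.+ j ⟧ ≈ ⟦ i ⟧ + ⟦ j ⟧
    ⟦⟧-+ (+ m)      (+ n)      = ×-homo-+ 1# m n
    ⟦⟧-+ (+ m)      (-[1+ n ]) = ⟦⟧-⊖ m (suc n)
    ⟦⟧-+ (-[1+ m ]) (+ n)      = trans (⟦⟧-⊖ n (suc m)) (+-comm _ _)
    ⟦⟧-+ (-[1+ m ]) (-[1+ n ]) = begin
      - (suc (suc (m ℕ.+ n)) × 1#)      ≡⟨ ≡.cong (λ k → - (suc k × 1#)) (ℕ.+-suc m n) ⟨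
      - ((suc m ℕ.+ suc n) × 1#)        ≈⟨ -‿cong (×-homo-+ 1# (suc m) (suc n)) ⟩
      - (suc m × 1# + suc n × 1#)       ≈⟨ -‿+-comm _ _ ⟨
      - (suc m × 1#) - suc n × 1#       ∎

    ⟦⟧-pos-* : ∀ m j → ⟦ + m ℤ.* j ⟧ ≈ m × 1# * ⟦ j ⟧
    ⟦⟧-pos-* m (+ n) = trans (reflexive (≡.cong ⟦_⟧ (≡.sym (ℤ.pos-* m n)))) (×1-homo-* m n)
    ⟦⟧-pos-* m (-[1+ n ]) = begin
      ⟦ + m ℤ.* -[1+ n ] ⟧              ≡⟨ ≡.cong ⟦_⟧ (ℤ.neg-distribʳ-* (+ m) (+ suc n)) ⟨
      ⟦ ℤ.- (+ m ℤ.* + suc n) ⟧         ≈⟨ ⟦⟧-neg (+ m ℤ.* + suc n) ⟩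
      - ⟦ + m ℤ.* + suc n ⟧             ≈⟨ -‿cong (⟦⟧-pos-* m (+ suc n)) ⟩
      - (m × 1# * suc n × 1#)           ≈⟨ -‿distribʳ-* _ _ ⟩
      m × 1# * - (suc n × 1#)           ∎

    ⟦⟧-* : ∀ i j → ⟦ i ℤ.* j ⟧ ≈ ⟦ i ⟧ * ⟦ j ⟧
    ⟦⟧-* (+ m)      j = ⟦⟧-pos-* m j
    ⟦⟧-* (-[1+ m ]) j = begin
      ⟦ -[1+ m ] ℤ.* j ⟧                ≡⟨ ≡.cong ⟦_⟧ (ℤ.neg-distribˡ-* (+ suc m) j) ⟨
      ⟦ ℤ.- (+ suc m ℤ.* j) ⟧           ≈⟨ ⟦⟧-neg (+ suc m ℤ.* j) ⟩
      - ⟦ + suc m ℤ.* j ⟧               ≈⟨ -‿cong (⟦⟧-pos-* (suc m) j) ⟩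
      - (suc m × 1# * ⟦ j ⟧)            ≈⟨ -‿distribˡ-* _ _ ⟩
      - (suc m × 1#) * ⟦ j ⟧            ∎

    homomorphism : ℤ.+-*-rawRing -Raw-AlmostCommutative⟶ fromCommutativeRing R
    homomorphism = record
      { ⟦_⟧    = ⟦_⟧
      ; +-homo = ⟦⟧-+
      ; *-homo = ⟦⟧-*
      ; -‿homo = ⟦⟧-neg
      ; 0-homo = refl
      ; 1-homo = refl
      }

  open import Algebra.Solver.Ring ℤ.+-*-rawRing (fromCommutativeRing R) homomorphism
    (λ i j → map (λ i≡j → reflexive (≡.cong ⟦_⟧ i≡j)) (dec⇒maybe (i ℤ.≟ j))) public
    using (solve; _:=_; _:+_; _:*_; _:-_; :-_; con; Polynomial)

module HarmonicSums {c ℓ₁ ℓ₂} (F : HeytingField c ℓ₁ ℓ₂) (char0 : CharacteristicZero F) where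
  open HeytingField F
  open Notation F char0
  private
    commRing = HeytingCommutativeRing.commutativeRing heytingCommutativeRing
  open CommutativeRing commRing using (semiring)
  open import Algebra.Apartness.Properties.HeytingCommutativeRing heytingCommutativeRing
    using (x-0≈x)
  open import Algebra.Properties.Semiring.Mult semiring using (×-homo-+; ×1-homo-*)
  open import Algebra.Properties.Semiring.Exp semiring using (^-homo-*)
  open import Algebra.Properties.Semiring.Sum semiring
    using (sum-cong-≋; sum-init-last; *-distribˡ-sum; ∑-distrib-+)
  open import Relation.Binary.Reasoning.Setoid setoid
  open IntegerCoefficients commRing

  private
    :1 : ∀ {n} → Polynomial n
    :1 = con (+ 1)

  -- Division, reciprocals and finite sums.

  /-* : ∀ a {b} (b#0 : b # 0#) → a / b [ b#0 ] * b ≈ a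
  /-* a {b} b#0 = begin
    a * b⁻¹ * b            ≈⟨ *-assoc _ _ _ ⟩
    a * (b⁻¹ * b)          ≈⟨ *-congˡ (*-congˡ (x-0≈x b)) ⟨
    a * (b⁻¹ * (b - 0#))   ≈⟨ *-congˡ (proj₁ (proj₂ (#⇒invertible b#0))) ⟩
    a * 1#                 ≈⟨ *-identityʳ a ⟩
    a                      ∎
    where b⁻¹ = proj₁ (#⇒invertible b#0)

  *-cancelʳ : ∀ {a b} c → c # 0# → a * c ≈ b * c → a ≈ b
  *-cancelʳ {a} {b} c c#0 ac≈bc = begin
    a               ≈⟨ /-* a c#0 ⟨
    a * c⁻¹ * c     ≈⟨ swap a ⟩
    a * c * c⁻¹     ≈⟨ *-congʳ ac≈bc ⟩
    b * c * c⁻¹     ≈⟨ swap b ⟨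
    b * c⁻¹ * c     ≈⟨ /-* b c#0 ⟩
    b               ∎
    where
    c⁻¹ = proj₁ (#⇒invertible c#0)
    swap : ∀ u → u * c⁻¹ * c ≈ u * c * c⁻¹
    swap u = solve 3 (λ u v w → u :* v :* w := u :* w :* v) refl u c⁻¹ c

  -- An inverse obtained from apartness depends on the proof supplied; this identifies inverses
  -- obtained from different proofs.
  inverse-unique : ∀ {b u v} → b * u ≈ 1# → b * v ≈ 1# → u ≈ v
  inverse-unique {b} {u} {v} bu≈1 bv≈1 = begin
    u             ≈⟨ *-identityʳ u ⟨
    u * 1#        ≈⟨ *-congˡ bv≈1 ⟨
    u * (b * v)   ≈⟨ solve 3 (λ u b v → u :* (b :* v) := b :* u :* v) refl u b v ⟩
    b * u * v     ≈⟨ *-congʳ bu≈1 ⟩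
    1# * v        ≈⟨ *-identityˡ v ⟩
    v             ∎

  -- The inverses become values of one total function on ℕ, so that sums over them can be rearranged
  -- without carrying bounds.
  reciprocals : ∀ n (f : ℕ → Carrier) → (∀ i → i < n → f i # 0#) →
                ∃ λ (r : ℕ → Carrier) → ∀ i → i < n → f i * r i ≈ 1#
  reciprocals n f f#0 = r , f*r≈1
    where
    r : ℕ → Carrier
    r i with i ℕ.<? n
    ... | yes i<n = 1# / f i [ f#0 i i<n ]
    -- A default outside the range `i < n`, about which nothing is claimed.
    ... | no  _   = 0#

    f*r≈1 : ∀ i → i < n → f i * r i ≈ 1#
    f*r≈1 i i<n with i ℕ.<? n
    ... | yes p   = trans (*-comm _ _) (/-* 1# (f#0 i p))
    ... | no  i≮n = contradiction i<n i≮n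

  ∑-last : ∀ n (f : ℕ → Carrier) →
           ∑[ i ≤ n ] f (toℕ i) ≈ ∑[ i < n ] f (toℕ i) + f n
  ∑-last n f = begin
    ∑[ i ≤ n ] f (toℕ i)                                ≈⟨ sum-init-last {n} (λ i → f (toℕ i)) ⟩
    ∑[ i < n ] f (toℕ (inject₁ i)) + f (toℕ (fromℕ n))  ≈⟨ +-cong
      (sum-cong-≋ {n} λ i → reflexive (≡.cong f (toℕ-inject₁ i)))
      (reflexive (≡.cong f (toℕ-fromℕ n))) ⟩
    ∑[ i < n ] f (toℕ i) + f n                          ∎

  ∑-*ˡ : ∀ n a (f : ℕ → Carrier) →
         a * ∑[ i < n ] f (toℕ i) ≈ ∑[ i < n ] (a * f (toℕ i))
  ∑-*ˡ n a f = *-distribˡ-sum {n} a (λ i → f (toℕ i))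

  ∑-cong-< : ∀ n {f g : ℕ → Carrier} → (∀ i → i < n → f i ≈ g i) →
             ∑[ i < n ] f (toℕ i) ≈ ∑[ i < n ] g (toℕ i)
  ∑-cong-< n f≈g = sum-cong-≋ {n} λ i → f≈g (toℕ i) (toℕ<n i)

  -- Summation by parts, with `h` the partial sums of `r`. The boundary term at 0 vanishes with
  -- `h 0`; the one at `m` remains.
  abel : ∀ (e r h : ℕ → Carrier) → h 0 ≈ 0# → (∀ k → h (suc k) ≈ h k + r k) → ∀ m →
         ∑[ k < m ] ((e (toℕ k) - e (suc (toℕ k))) * h (toℕ k))
         ≈ ∑[ k < m ] (e (suc (toℕ k)) * r (toℕ k)) - e m * h m
  abel e r h h₀ h₊ zero = sym (begin
    0# - e 0 * h 0   ≈⟨ +-congˡ (-‿cong (*-congˡ h₀)) ⟩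
    0# - e 0 * 0#    ≈⟨ solve 1 (λ e → con (+ 0) :- e :* con (+ 0) := con (+ 0)) refl (e 0) ⟩
    0#               ∎)
  abel e r h h₀ h₊ (suc m) = begin
    ∑[ k < suc m ] ((e (toℕ k) - e (suc (toℕ k))) * h (toℕ k))
      ≈⟨ ∑-last m (λ k → (e k - e (suc k)) * h k) ⟩
    ∑[ k < m ] ((e (toℕ k) - e (suc (toℕ k))) * h (toℕ k)) + (e m - e (suc m)) * h m
      ≈⟨ +-congʳ (abel e r h h₀ h₊ m) ⟩
    S - e m * h m + (e m - e (suc m)) * h m
      ≈⟨ solve 5 (λ S e e′ h r → S :- e :* h :+ (e :- e′) :* h := S :+ e′ :* r :- e′ :* (h :+ r))
           refl S (e m) (e (suc m)) (h m) (r m) ⟩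
    S + e (suc m) * r m - e (suc m) * (h m + r m)
      ≈⟨ +-cong (∑-last m (λ k → e (suc k) * r k)) (-‿cong (*-congˡ (h₊ m))) ⟨
    ∑[ k < suc m ] (e (suc (toℕ k)) * r (toℕ k)) - e (suc m) * h (suc m)
      ∎
    where S = ∑[ k < m ] (e (suc (toℕ k)) * r (toℕ k))

  -- Signs and falling factorials.

  ε : ℕ → Carrier
  ε n = (- 1#) ^ n

  ε²≈1 : ∀ n → ε n * ε n ≈ 1#
  ε²≈1 zero    = *-identityˡ 1#
  ε²≈1 (suc n) = trans
    (solve 1 (λ e → :- :1 :* e :* (:- :1 :* e) := e :* e) refl (ε n))
    (ε²≈1 n)

  ε-cancel : ∀ n {a b} → ε n * a ≈ ε n * b → a ≈ b
  ε-cancel n {a} {b} εa≈εb = begin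
    a                 ≈⟨ absorb a ⟨
    ε n * (ε n * a)   ≈⟨ *-congˡ εa≈εb ⟩
    ε n * (ε n * b)   ≈⟨ absorb b ⟩
    b                 ∎
    where
    absorb : ∀ u → ε n * (ε n * u) ≈ u
    absorb u = trans (sym (*-assoc _ _ _)) (trans (*-congʳ (ε²≈1 n)) (*-identityˡ u))

  ι-+ : ∀ m n → ι (m ℕ.+ n) ≈ ι m + ι n
  ι-+ = ×-homo-+ 1#

  ι-* : ∀ m n → ι (m ℕ.* n) ≈ ι m * ι n
  ι-* = ×1-homo-*

  falling-cong : ∀ {u v} k → u ≈ v → falling u k ≈ falling v k
  falling-cong zero    u≈v = refl
  falling-cong (suc k) u≈v = *-cong (falling-cong k u≈v) (+-congʳ u≈v)

  falling-+ : ∀ u m k → falling u (m ℕ.+ k) ≈ falling u m * falling (u - ι m) k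
  falling-+ u m zero = trans (reflexive (≡.cong (falling u) (ℕ.+-identityʳ m))) (sym (*-identityʳ _))
  falling-+ u m (suc k) = begin
    falling u (m ℕ.+ suc k)                                ≡⟨ ≡.cong (falling u) (ℕ.+-suc m k) ⟩
    falling u (m ℕ.+ k) * (u - ι (m ℕ.+ k))                ≈⟨ *-cong (falling-+ u m k) (+-congˡ (-‿cong (ι-+ m k))) ⟩
    falling u m * falling (u - ι m) k * (u - (ι m + ι k))  ≈⟨ solve 5 (λ f g u m k → f :* g :* (u :- (m :+ k)) := f :* (g :* (u :- m :- k))) refl _ _ u (ι m) (ι k) ⟩
    falling u m * falling (u - ι m) (suc k)                ∎

  -- By definition `falling` splits off its last factor; splitting after one factor gives the first.
  -- The clean-up is due to `ι 1` unfolding to `1# + 0#`.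
  falling-suc : ∀ u k → falling u (suc k) ≈ u * falling (u - 1#) k
  falling-suc u k = begin
    falling u (1 ℕ.+ k)                       ≈⟨ falling-+ u 1 k ⟩
    1# * (u - 0#) * falling (u - (1# + 0#)) k ≈⟨ *-cong (trans (*-identityˡ _) (x-0≈x u)) (falling-cong k (+-congˡ (-‿cong (+-identityʳ 1#)))) ⟩
    u * falling (u - 1#) k                    ∎

  falling-ι : ∀ n → falling (ι n) n ≈ ι (n !)
  falling-ι zero    = sym (+-identityʳ 1#)
  falling-ι (suc n) = begin
    falling (ι (suc n)) (suc n)               ≈⟨ falling-suc (ι (suc n)) n ⟩
    ι (suc n) * falling (1# + ι n - 1#) n     ≈⟨ *-congˡ (falling-cong n (solve 1 (λ m → :1 :+ m :- :1 := m) refl (ι n))) ⟩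
    ι (suc n) * falling (ι n) n               ≈⟨ *-congˡ (falling-ι n) ⟩
    ι (suc n) * ι (n !)                       ≈⟨ ι-* (suc n) (n !) ⟨
    ι (suc n !)                               ∎

  -- Changing the sign of each factor -1 - u, ..., -n - u yields the factors of
  -- `falling (u + ι n) n` in reverse order.
  falling-negate : ∀ u n → falling (- 1# - u) n ≈ ε n * falling (u + ι n) n
  falling-negate u zero    = sym (*-identityˡ 1#)
  falling-negate u (suc n) = begin
    falling (- 1# - u) n * (- 1# - u - ι n)                 ≈⟨ *-congʳ (falling-negate u n) ⟩
    ε n * falling (u + ι n) n * (- 1# - u - ι n)            ≈⟨ solve 4 (λ e f u n → e :* f :* (:- :1 :- u :- n) := :- :1 :* e :* ((u :+ (:1 :+ n)) :* f)) refl (ε n) _ u (ι n) ⟩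
    ε (suc n) * ((u + ι (suc n)) * falling (u + ι n) n)     ≈⟨ *-congˡ (*-congˡ (falling-cong n (solve 2 (λ u n → u :+ n := u :+ (:1 :+ n) :- :1) refl u (ι n)))) ⟩
    ε (suc n) * ((u + ι (suc n)) * falling (u + ι (suc n) - 1#) n)  ≈⟨ *-congˡ (falling-suc (u + ι (suc n)) n) ⟨
    ε (suc n) * falling (u + ι (suc n)) (suc n)             ∎

  -- Binomial coefficients and their recurrences.

  ι#0 : ∀ k → ι (suc k) # 0#
  ι#0 k = char0 (suc k)

  binom-*! : ∀ u k → binom u k * ι (k !) ≈ falling u k
  binom-*! u k = /-* (falling u k) (k!#0 k)

  binom-cong : ∀ {u v} k → u ≈ v → binom u k ≈ binom v k
  binom-cong k u≈v = *-congʳ (falling-cong k u≈v)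

  binom-zero : ∀ u → binom u 0 ≈ 1#
  binom-zero u = *-cancelʳ (ι 1) (k!#0 0) (trans (binom-*! u 0) (sym (trans (*-identityˡ _) (+-identityʳ 1#))))

  binom-suc : ∀ u k → binom u (suc k) * ι (suc k) ≈ binom u k * (u - ι k)
  binom-suc u k = *-cancelʳ (ι (k !)) (k!#0 k) (begin
    binom u (suc k) * ι (suc k) * ι (k !)     ≈⟨ *-assoc _ _ _ ⟩
    binom u (suc k) * (ι (suc k) * ι (k !))   ≈⟨ *-congˡ (ι-* (suc k) (k !)) ⟨
    binom u (suc k) * ι (suc k !)             ≈⟨ binom-*! u (suc k) ⟩
    falling u k * (u - ι k)                   ≈⟨ *-congʳ (binom-*! u k) ⟨
    binom u k * ι (k !) * (u - ι k)           ≈⟨ solve 3 (λ a b c → a :* b :* c := a :* c :* b) refl _ _ _ ⟩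
    binom u k * (u - ι k) * ι (k !)           ∎)

  binom-absorb : ∀ u k → binom u (suc k) * ι (suc k) ≈ u * binom (u - 1#) k
  binom-absorb u k = *-cancelʳ (ι (k !)) (k!#0 k) (begin
    binom u (suc k) * ι (suc k) * ι (k !)     ≈⟨ *-assoc _ _ _ ⟩
    binom u (suc k) * (ι (suc k) * ι (k !))   ≈⟨ *-congˡ (ι-* (suc k) (k !)) ⟨
    binom u (suc k) * ι (suc k !)             ≈⟨ binom-*! u (suc k) ⟩
    falling u (suc k)                         ≈⟨ falling-suc u k ⟩
    u * falling (u - 1#) k                    ≈⟨ *-congˡ (binom-*! (u - 1#) k) ⟨
    u * (binom (u - 1#) k * ι (k !))          ≈⟨ *-assoc _ _ _ ⟨
    u * binom (u - 1#) k * ι (k !)            ∎)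

  -- After multiplication by k + 1 every term is a multiple of `binom (u - 1#) k`, and the factors k
  -- + 1 and u - 1 - k on the right add up to u.
  pascal : ∀ u k → binom u (suc k) ≈ binom (u - 1#) k + binom (u - 1#) (suc k)
  pascal u k = *-cancelʳ (ι (suc k)) (ι#0 k) (begin
    binom u (suc k) * ι (suc k)          ≈⟨ binom-absorb u k ⟩
    u * b                                ≈⟨ solve 3 (λ u b k → u :* b := b :* (:1 :+ k) :+ b :* (u :- :1 :- k)) refl u b (ι k) ⟩
    b * ι (suc k) + b * (u - 1# - ι k)   ≈⟨ +-congˡ (binom-suc (u - 1#) k) ⟨
    b * ι (suc k) + b′ * ι (suc k)       ≈⟨ distribʳ _ _ _ ⟨
    (b + b′) * ι (suc k)                 ∎)
    where
    b  = binom (u - 1#) k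
    b′ = binom (u - 1#) (suc k)

  -- Coefficient sequences of the four powers of 1 - t.

  module _ (y : Carrier) where

    A a B b : ℕ → Carrier
    A k = binom (y + ι k) k
    a k = binom (y + ι k - 1#) k
    B k = ε k * binom (y - 1#) k
    b k = ε k * binom y k

    A-zero : A 0 ≈ 1#
    A-zero = binom-zero (y + ι 0)

    a-zero : a 0 ≈ 1#
    a-zero = binom-zero (y + ι 0 - 1#)

    B-zero : B 0 ≈ 1#
    B-zero = trans (*-identityˡ _) (binom-zero (y - 1#))

    b-zero : b 0 ≈ 1#
    b-zero = trans (*-identityˡ _) (binom-zero y)

    -- Coefficientwise form of (1 - t)⁻ʸ = (1 - t) (1 - t)⁻ʸ⁻¹.
    A-suc : ∀ k → A (suc k) ≈ A k + a (suc k)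
    A-suc k = trans (pascal (y + ι (suc k)) k)
      (+-congʳ (binom-cong k (solve 2 (λ y k → y :+ (:1 :+ k) :- :1 := y :+ k) refl y (ι k))))

    -- Coefficientwise, the derivative of (1 - t)⁻ʸ is y (1 - t)⁻ʸ⁻¹.
    a-suc : ∀ k → a (suc k) * ι (suc k) ≈ y * A k
    a-suc k = begin
      a (suc k) * ι (suc k)                                     ≈⟨ binom-suc _ k ⟩
      binom (y + (1# + ι k) - 1#) k * (y + (1# + ι k) - 1# - ι k) ≈⟨ *-cong
        (binom-cong k (solve 2 (λ y k → y :+ (:1 :+ k) :- :1 := y :+ k) refl y (ι k)))
        (solve 2 (λ y k → y :+ (:1 :+ k) :- :1 :- k := y) refl y (ι k)) ⟩
      A k * y                                                   ≈⟨ *-comm _ _ ⟩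
      y * A k                                                   ∎

    -- Coefficientwise, the derivative of (1 - t)ʸ is -y (1 - t)ʸ⁻¹.
    b-suc : ∀ k → b (suc k) * ι (suc k) ≈ - (y * B k)
    b-suc k = begin
      ε (suc k) * binom y (suc k) * ι (suc k)     ≈⟨ *-assoc _ _ _ ⟩
      ε (suc k) * (binom y (suc k) * ι (suc k))   ≈⟨ *-congˡ (binom-absorb y k) ⟩
      ε (suc k) * (y * binom (y - 1#) k)          ≈⟨ solve 3 (λ e y b → :- :1 :* e :* (y :* b) := :- (y :* (e :* b))) refl (ε k) y _ ⟩
      - (y * B k)                                 ∎

    -- Coefficientwise form of (1 - t)ʸ = (1 - t) (1 - t)ʸ⁻¹.
    B-suc : ∀ k → B (suc k) ≈ B k + b (suc k)
    B-suc k = begin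
      ε (suc k) * β′                      ≈⟨ solve 3 (λ e β β′ → :- :1 :* e :* β′ := e :* β :+ :- :1 :* e :* (β :+ β′)) refl (ε k) β β′ ⟩
      ε k * β + ε (suc k) * (β + β′)      ≈⟨ +-congˡ (*-congˡ (pascal y k)) ⟨
      B k + b (suc k)                     ∎
      where
      β  = binom (y - 1#) k
      β′ = binom (y - 1#) (suc k)

    -- Eliminating `b` leaves a first-order recurrence for `B` alone, which compares `ρ (suc n)`
    -- with `ρ n` in the induction on `n`.
    B-rec : ∀ k → B (suc k) * ι (suc k) ≈ B k * (ι (suc k) - y)
    B-rec k = begin
      B (suc k) * ι (suc k)                     ≈⟨ *-congʳ (B-suc k) ⟩
      (B k + b (suc k)) * ι (suc k)             ≈⟨ distribʳ _ _ _ ⟩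
      B k * ι (suc k) + b (suc k) * ι (suc k)   ≈⟨ +-congˡ (b-suc k) ⟩
      B k * ι (suc k) - y * B k                 ≈⟨ solve 3 (λ B i y → B :* i :- y :* B := B :* (i :- y)) refl (B k) _ y ⟩
      B k * (ι (suc k) - y)                     ∎

    -- Partial fractions in x.

    ρ : ℕ → ℕ → Carrier
    ρ n i = A i * B (n ∸ suc i)

    -- The expansion of the quotient of the two falling factorials, multiplied out; its residue at x
    -- = -(i + 1) is -y times `ρ n i`. Quantifying over `x` and over the inverses `r` lets the
    -- induction evaluate the expansion at a point of its choice.
    PartialFractions : ℕ → Set _
    PartialFractions n = ∀ x (r : ℕ → Carrier) → (∀ i → i < n → (x + ι (suc i)) * r i ≈ 1#) →
      falling (x - y + ι n) n
      ≈ falling (x + ι n) n * (1# - y * ∑[ i < n ] (ρ n (toℕ i) * r (toℕ i)))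

    module _ (n : ℕ) (pf : PartialFractions n) where

      private
        -- For `i < n` this is 1 / (n - i), the reciprocal of the distance between the old pole -(i
        -- + 1) and the new pole -(n + 1). Writing n - i as a successor makes it visibly invertible.
        δ : ℕ → Carrier
        δ i = 1# / ι (suc (n ∸ suc i)) [ ι#0 (n ∸ suc i) ]

        D : Carrier
        D = ∑[ i < n ] (ρ n (toℕ i) * δ (toℕ i))

      -- The coefficient of a new pole is the value at that pole of the expansion found so far.
      A-value : A n ≈ 1# + y * D
      A-value = *-cancelʳ (ι (n !)) (k!#0 n) (ε-cancel n (begin
        ε n * (A n * ι (n !))                         ≈⟨ *-congˡ (binom-*! _ n) ⟩
        ε n * falling (y + ι n) n                     ≈⟨ falling-negate y n ⟨
        falling (- 1# - y) n                          ≈⟨ falling-cong n (solve 2 (λ y m → :- :1 :- y := :- (:1 :+ m) :- y :+ m) refl y (ι n)) ⟩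
        falling (x₀ - y + ι n) n                      ≈⟨ pf x₀ (λ i → - δ i) inverses ⟩
        falling (x₀ + ι n) n * (1# - y * ∑[ i < n ] (ρ n (toℕ i) * - δ (toℕ i)))
                                                      ≈⟨ *-cong fact (+-congˡ (-‿cong (*-congˡ (sum-cong-≋ {n} λ i → negate (ρ n (toℕ i)) (δ (toℕ i)))))) ⟩
        ε n * ι (n !) * (1# - y * ∑[ i < n ] (- 1# * (ρ n (toℕ i) * δ (toℕ i))))
                                                      ≈⟨ *-congˡ (+-congˡ (-‿cong (*-congˡ (∑-*ˡ n (- 1#) (λ i → ρ n i * δ i))))) ⟨
        ε n * ι (n !) * (1# - y * (- 1# * D))         ≈⟨ solve 4 (λ e f y D → e :* f :* (:1 :- y :* (:- :1 :* D)) := e :* ((:1 :+ y :* D) :* f)) refl (ε n) _ y D ⟩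
        ε n * ((1# + y * D) * ι (n !))                ∎))
        where
        -- The new pole. At it the two falling factorials start at -1 - y and at -1, so reflection
        -- turns them into (-1)ⁿ n! times `A n` and times 1.
        x₀ = - ι (suc n)

        negate : ∀ u v → u * - v ≈ - 1# * (u * v)
        negate = solve 2 (λ u v → u :* :- v := :- :1 :* (u :* v)) refl

        fact : falling (x₀ + ι n) n ≈ ε n * ι (n !)
        fact = begin
          falling (x₀ + ι n) n        ≈⟨ falling-cong n (solve 1 (λ m → :- (:1 :+ m) :+ m := :- :1 :- con (+ 0)) refl (ι n)) ⟩
          falling (- 1# - 0#) n       ≈⟨ falling-negate 0# n ⟩
          ε n * falling (0# + ι n) n  ≈⟨ *-congˡ (falling-cong n (+-identityˡ _)) ⟩
          ε n * falling (ι n) n       ≈⟨ *-congˡ (falling-ι n) ⟩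
          ε n * ι (n !)               ∎

        inverses : ∀ i → i < n → (x₀ + ι (suc i)) * - δ i ≈ 1#
        inverses i i<n = begin
          (- (1# + ι n) + ι (suc i)) * - δ i     ≈⟨ *-congʳ (+-congʳ (-‿cong (+-congˡ (ι-∸-+ i<n)))) ⟩
          (- (1# + (m + ι (suc i))) + ι (suc i)) * - δ i
                                                 ≈⟨ solve 3 (λ m j d → (:- (:1 :+ (m :+ j)) :+ j) :* :- d := d :* (:1 :+ m)) refl m (ι (suc i)) (δ i) ⟩
          δ i * (1# + m)                         ≈⟨ /-* 1# (ι#0 (n ∸ suc i)) ⟩
          1#                                     ∎
          where m = ι (n ∸ suc i)

      -- Numerator and denominator gain the first factors `z - y` and `z`, where z = x + n + 1, so
      -- the claim reduces to `z * s′ ≈ (z - y) * s + 1#`.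
      partialFractions-suc : PartialFractions (suc n)
      partialFractions-suc x r inv = begin
        falling (x - y + ι (suc n)) (suc n)
          ≈⟨ falling-shift (x - y) ⟩
        (x - y + ι (suc n)) * falling (x - y + ι n) n
          ≈⟨ *-congˡ (pf x r (λ i i<n → inv i (ℕ.m<n⇒m<1+n i<n))) ⟩
        (x - y + ι (suc n)) * (f * (1# - y * s))
          ≈⟨ solve 5 (λ x y N f s → (x :- y :+ N) :* (f :* (:1 :- y :* s)) := f :* (x :+ N :- y :* ((x :+ N :- y) :* s :+ :1))) refl x y (ι (suc n)) f s ⟩
        f * (z - y * ((z - y) * s + 1#))
          ≈⟨ *-congˡ (+-congˡ (-‿cong (*-congˡ step))) ⟨
        f * (z - y * (z * s′))
          ≈⟨ solve 4 (λ f z y s → f :* (z :- y :* (z :* s)) := z :* f :* (:1 :- y :* s)) refl f z y s′ ⟩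
        z * f * (1# - y * s′)
          ≈⟨ *-congʳ (falling-shift x) ⟨
        falling (x + ι (suc n)) (suc n) * (1# - y * s′)
          ∎
        where
        z = x + ι (suc n)
        f = falling (x + ι n) n
        s = ∑[ i < n ] (ρ n (toℕ i) * r (toℕ i))
        s′ = ∑[ i ≤ n ] (ρ (suc n) (toℕ i) * r (toℕ i))

        falling-shift : ∀ u → falling (u + ι (suc n)) (suc n) ≈ (u + ι (suc n)) * falling (u + ι n) n
        falling-shift u = trans (falling-suc _ n) (*-congˡ (falling-cong n
          (solve 2 (λ u m → u :+ (:1 :+ m) :- :1 := u :+ m) refl u (ι n))))

        -- An old pole keeps its shape up to the factor `z - y`; the remainder does not involve `x`,
        -- and over all `i` these remainders add up to `- y * D`.
        term : ∀ i → i < n →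
               z * (ρ (suc n) i * r i) ≈ (z - y) * (ρ n i * r i) + - y * (ρ n i * δ i)
        term i i<n = begin
          z * (A i * B (n ∸ i) * r i)
            ≈⟨ *-cong z≈w+M (*-congʳ (*-congˡ (reflexive (≡.cong B (ℕ.+-∸-assoc 1 i<n))))) ⟩
          (w + M) * (A i * B (suc m) * r i)
            ≈⟨ solve 5 (λ w M A B r → (w :+ M) :* (A :* B :* r) := A :* B :* (w :* r :+ M :* r)) refl w M (A i) (B (suc m)) (r i) ⟩
          A i * B (suc m) * (w * r i + M * r i)
            -- Trading `w * r i` for `δ i * M`, both equal to 1, brings out the factor `M` that
            -- `B-rec` consumes. The trade is undone afterwards.
            ≈⟨ *-congˡ (+-congʳ wr≈δM) ⟩
          A i * B (suc m) * (δ i * M + M * r i)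
            ≈⟨ solve 5 (λ M A B r d → A :* B :* (d :* M :+ M :* r) := A :* (B :* M) :* (d :+ r)) refl M (A i) (B (suc m)) (r i) (δ i) ⟩
          A i * (B (suc m) * M) * (δ i + r i)
            ≈⟨ *-congʳ (*-congˡ (B-rec m)) ⟩
          A i * (B m * (M - y)) * (δ i + r i)
            ≈⟨ solve 6 (λ M A B r d y → A :* (B :* (M :- y)) :* (d :+ r) := A :* B :* (d :* M :+ M :* r :- y :* d :- y :* r)) refl M (A i) (B m) (r i) (δ i) y ⟩
          ρ n i * (δ i * M + M * r i - y * δ i - y * r i)
            ≈⟨ *-congˡ (+-congʳ (+-congʳ (+-congʳ wr≈δM))) ⟨
          ρ n i * (w * r i + M * r i - y * δ i - y * r i)
            ≈⟨ solve 6 (λ M w R r d y → R :* (w :* r :+ M :* r :- y :* d :- y :* r) := (w :+ M :- y) :* (R :* r) :+ :- y :* (R :* d)) refl M w (ρ n i) (r i) (δ i) y ⟩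
          (w + M - y) * (ρ n i * r i) + - y * (ρ n i * δ i)
            ≈⟨ +-congʳ (*-congʳ (+-congʳ z≈w+M)) ⟨
          (z - y) * (ρ n i * r i) + - y * (ρ n i * δ i)
            ∎
          where
          m = n ∸ suc i
          M = ι (suc m)
          w = x + ι (suc i)

          z≈w+M : z ≈ w + M
          z≈w+M = trans (+-congˡ (+-congˡ (ι-∸-+ i<n)))
            (solve 3 (λ x m j → x :+ (:1 :+ (m :+ j)) := x :+ j :+ (:1 :+ m)) refl x (ι m) (ι (suc i)))

          wr≈δM : w * r i ≈ δ i * M
          wr≈δM = trans (inv i (ℕ.m<n⇒m<1+n i<n)) (sym (/-* 1# (ι#0 m)))

        -- The factor `z` cancels the new pole. What is left supplies the 1 of `step` and a `y * D`
        -- against the remainders of the old poles.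
        last-term : z * (ρ (suc n) n * r n) ≈ 1# + y * D
        last-term = begin
          z * (A n * B (n ∸ n) * r n)   ≈⟨ *-congˡ (*-congʳ (*-congˡ (trans (reflexive (≡.cong B (ℕ.n∸n≡0 n))) B-zero))) ⟩
          z * (A n * 1# * r n)          ≈⟨ solve 3 (λ z A r → z :* (A :* :1 :* r) := z :* r :* A) refl z (A n) (r n) ⟩
          z * r n * A n                 ≈⟨ *-cong (inv n ℕ.≤-refl) A-value ⟩
          1# * (1# + y * D)             ≈⟨ *-identityˡ _ ⟩
          1# + y * D                    ∎

        step : z * s′ ≈ (z - y) * s + 1#
        step = begin
          z * s′
            ≈⟨ ∑-*ˡ (suc n) z (λ i → ρ (suc n) i * r i) ⟩
          ∑[ i ≤ n ] (z * (ρ (suc n) (toℕ i) * r (toℕ i)))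
            ≈⟨ ∑-last n (λ i → z * (ρ (suc n) i * r i)) ⟩
          ∑[ i < n ] (z * (ρ (suc n) (toℕ i) * r (toℕ i))) + z * (ρ (suc n) n * r n)
            ≈⟨ +-cong (∑-cong-< n term) last-term ⟩
          ∑[ i < n ] ((z - y) * (ρ n (toℕ i) * r (toℕ i)) + - y * (ρ n (toℕ i) * δ (toℕ i))) + (1# + y * D)
            ≈⟨ +-congʳ (∑-distrib-+ {n} (λ i → (z - y) * (ρ n (toℕ i) * r (toℕ i))) _) ⟩
          ∑[ i < n ] ((z - y) * (ρ n (toℕ i) * r (toℕ i))) + ∑[ i < n ] (- y * (ρ n (toℕ i) * δ (toℕ i))) + (1# + y * D)
            ≈⟨ +-congʳ (+-cong (∑-*ˡ n (z - y) (λ i → ρ n i * r i)) (∑-*ˡ n (- y) (λ i → ρ n i * δ i))) ⟨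
          (z - y) * s + - y * D + (1# + y * D)
            ≈⟨ solve 4 (λ z s y D → (z :- y) :* s :+ :- y :* D :+ (:1 :+ y :* D) := (z :- y) :* s :+ :1) refl z s y D ⟩
          (z - y) * s + 1#
            ∎

    partialFractions : ∀ n → PartialFractions n
    partialFractions zero    x r inv = solve 1 (λ y → :1 := :1 :* (:1 :- y :* con (+ 0))) refl y
    partialFractions (suc n) = partialFractions-suc n (partialFractions n)

    -- Telescoping and summation by parts.

    U : ℕ → ℕ → Carrier
    -- Stands for `A` at -1 times `B n`, so that the summand at 0 telescopes like the others.
    U n zero    = 0#
    U n (suc i) = ρ n i

    -- Split n = (n - k) + k. The part n - k differentiates `b`, the part k differentiates `a`;
    -- adding and subtracting y A (k - 1) B (n - k - 1) then completes the increments of `A` and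
    -- `B`.
    telescope-< : ∀ n k → k < n → ι n * (a k * b (n ∸ k)) ≈ y * (U n k - U n (suc k))
    telescope-< (suc m) zero k<n = begin
      ι (suc m) * (a 0 * b (suc m))     ≈⟨ *-congˡ (*-congʳ a-zero) ⟩
      ι (suc m) * (1# * b (suc m))      ≈⟨ solve 2 (λ N b → N :* (:1 :* b) := b :* N) refl _ _ ⟩
      b (suc m) * ι (suc m)             ≈⟨ b-suc m ⟩
      - (y * B m)                       ≈⟨ solve 2 (λ y B → :- (y :* B) := y :* (con (+ 0) :- :1 :* B)) refl y (B m) ⟩
      y * (0# - 1# * B m)               ≈⟨ *-congˡ (+-congˡ (-‿cong (*-congʳ A-zero))) ⟨
      y * (0# - A 0 * B m)              ∎
    telescope-< n (suc i) i<n = begin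
      ι n * (a (suc i) * b (n ∸ suc i))
        ≈⟨ *-cong (ι-∸-+ (ℕ.<⇒≤ i<n)) (*-congˡ (reflexive (≡.cong b n∸i≡1+m))) ⟩
      (ι (n ∸ suc i) + I) * (a (suc i) * b (suc m))
        ≈⟨ *-congʳ (+-congʳ (reflexive (≡.cong ι n∸i≡1+m))) ⟩
      (M + I) * (a (suc i) * b (suc m))
        ≈⟨ solve 4 (λ M I a b → (M :+ I) :* (a :* b) := a :* (b :* M) :+ a :* I :* b) refl M I _ _ ⟩
      a (suc i) * (b (suc m) * M) + a (suc i) * I * b (suc m)
        ≈⟨ +-cong (*-congˡ (b-suc m)) (*-congʳ (a-suc i)) ⟩
      a (suc i) * - (y * B m) + y * A i * b (suc m)
        ≈⟨ solve 5 (λ a y B A b → a :* :- (y :* B) :+ y :* A :* b := y :* (A :* (B :+ b) :- (A :+ a) :* B)) refl (a (suc i)) y (B m) (A i) (b (suc m)) ⟩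
      y * (A i * (B m + b (suc m)) - (A i + a (suc i)) * B m)
        ≈⟨ *-congˡ (+-cong (*-congˡ (B-suc m)) (-‿cong (*-congʳ (A-suc i)))) ⟨
      y * (A i * B (suc m) - A (suc i) * B m)
        ≈⟨ *-congˡ (+-congʳ (*-congˡ (reflexive (≡.cong B n∸i≡1+m)))) ⟨
      y * (ρ n i - ρ n (suc i))
        ∎
      where
      m = n ∸ suc (suc i)
      M = ι (suc m)
      I = ι (suc i)

      n∸i≡1+m : n ∸ suc i ≡ suc m
      n∸i≡1+m = ℕ.+-∸-assoc 1 i<n

    -- At k = n truncated subtraction would produce `B 0` where the coefficient of index -1, namely
    -- 0, is meant. Hence the last summand is treated apart, with no second term.
    telescope-≡ : ∀ n .{{_ : NonZero n}} → ι n * (a n * b (n ∸ n)) ≈ y * U n n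
    telescope-≡ (suc i) = begin
      ι (suc i) * (a (suc i) * b (i ∸ i))   ≈⟨ *-congˡ (*-congˡ (trans (reflexive (≡.cong b (ℕ.n∸n≡0 i))) b-zero)) ⟩
      ι (suc i) * (a (suc i) * 1#)          ≈⟨ solve 2 (λ N a → N :* (a :* :1) := a :* N) refl _ _ ⟩
      a (suc i) * ι (suc i)                 ≈⟨ a-suc i ⟩
      y * A i                               ≈⟨ *-congˡ (*-identityʳ _) ⟨
      y * (A i * 1#)                        ≈⟨ *-congˡ (*-congˡ (trans (reflexive (≡.cong B (ℕ.n∸n≡0 i))) B-zero)) ⟨
      y * (A i * B (i ∸ i))                 ∎

    -- Summation by parts over k < n leaves the boundary term `- (y * (U n n * h n))`, which the
    -- summand at k = n cancels.
    convolution : ∀ n .{{_ : NonZero n}} (r h : ℕ → Carrier) →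
      h 0 ≈ 0# → (∀ k → h (suc k) ≈ h k + r k) →
      ι n * ∑[ k ≤ n ] (a (toℕ k) * b (n ∸ toℕ k) * h (toℕ k))
      ≈ y * ∑[ i < n ] (ρ n (toℕ i) * r (toℕ i))
    convolution n r h h₀ h₊ = begin
      ι n * ∑[ k ≤ n ] (a (toℕ k) * b (n ∸ toℕ k) * h (toℕ k))
        ≈⟨ ∑-*ˡ (suc n) (ι n) (λ k → a k * b (n ∸ k) * h k) ⟩
      ∑[ k ≤ n ] (ι n * (a (toℕ k) * b (n ∸ toℕ k) * h (toℕ k)))
        ≈⟨ ∑-last n (λ k → ι n * (a k * b (n ∸ k) * h k)) ⟩
      ∑[ k < n ] (ι n * (a (toℕ k) * b (n ∸ toℕ k) * h (toℕ k))) + ι n * (a n * b (n ∸ n) * h n)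
        ≈⟨ +-cong (∑-cong-< n term) (trans (sym (*-assoc _ _ _)) (trans (*-congʳ (telescope-≡ n)) (*-assoc _ _ _))) ⟩
      ∑[ k < n ] (y * ((U n (toℕ k) - U n (suc (toℕ k))) * h (toℕ k))) + y * (U n n * h n)
        ≈⟨ +-congʳ (∑-*ˡ n y (λ k → (U n k - U n (suc k)) * h k)) ⟨
      y * ∑[ k < n ] ((U n (toℕ k) - U n (suc (toℕ k))) * h (toℕ k)) + y * (U n n * h n)
        ≈⟨ +-congʳ (*-congˡ (abel (U n) r h h₀ h₊ n)) ⟩
      y * (S - U n n * h n) + y * (U n n * h n)
        ≈⟨ solve 3 (λ y S u → y :* (S :- u) :+ y :* u := y :* S) refl y S (U n n * h n) ⟩
      y * S
        ∎
      where
      S = ∑[ i < n ] (ρ n (toℕ i) * r (toℕ i))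

      term : ∀ k → k < n → ι n * (a k * b (n ∸ k) * h k) ≈ y * ((U n k - U n (suc k)) * h k)
      term k k<n = begin
        ι n * (a k * b (n ∸ k) * h k)         ≈⟨ *-assoc _ _ _ ⟨
        ι n * (a k * b (n ∸ k)) * h k         ≈⟨ *-congʳ (telescope-< n k k<n) ⟩
        y * (U n k - U n (suc k)) * h k       ≈⟨ *-assoc _ _ _ ⟩
        y * ((U n k - U n (suc k)) * h k)     ∎

    -- Rewriting both sides of the identity in these sequences.

    binom-*-shift : ∀ k → binom (y + ι k) k * y ≈ a k * (y + ι k)
    binom-*-shift k = *-cancelʳ (ι (k !)) (k!#0 k) (begin
      binom (y + ι k) k * y * ι (k !)          ≈⟨ solve 3 (λ u v w → u :* v :* w := u :* w :* v) refl _ _ _ ⟩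
      binom (y + ι k) k * ι (k !) * y          ≈⟨ *-congʳ (binom-*! _ k) ⟩
      falling (y + ι k) k * y                  ≈⟨ *-congˡ (solve 2 (λ y k → y :+ k :- k := y) refl y (ι k)) ⟨
      -- The common value of both sides times k!: its last factor is `y`, its first is `y + ι k`.
      falling (y + ι k) (suc k)                ≈⟨ falling-suc _ k ⟩
      (y + ι k) * falling (y + ι k - 1#) k     ≈⟨ *-congˡ (binom-*! _ k) ⟨
      (y + ι k) * (a k * ι (k !))              ≈⟨ solve 3 (λ u v w → u :* (v :* w) := v :* u :* w) refl _ _ _ ⟩
      a k * (y + ι k) * ι (k !)                ∎)

    -- Multiplied by k! (n - k)!, both sides are `falling y n`: on the left the factorials complete
    -- to n!, on the right the product is cut after n - k factors.
    trinomial-revision : ∀ {n k} → k ≤ n →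
      binom (ι n) k * binom y n ≈ binom y (n ∸ k) * binom (y - ι n + ι k) k
    trinomial-revision {n} {k} k≤n =
      *-cancelʳ (ι (m !)) (k!#0 m) (*-cancelʳ (ι (k !)) (k!#0 k) (begin
        binom (ι n) k * binom y n * ι (m !) * ι (k !)
          ≈⟨ solve 4 (λ u v w t → u :* v :* w :* t := v :* (u :* t :* w)) refl _ _ _ _ ⟩
        binom y n * (binom (ι n) k * ι (k !) * ι (m !))
          ≈⟨ *-congˡ (*-cong (binom-*! (ι n) k) (sym (falling-ι m))) ⟩
        binom y n * (falling (ι n) k * falling (ι m) m)
          ≈⟨ *-congˡ (*-congˡ (falling-cong m (trans (+-congʳ (ι-∸-+ k≤n)) (solve 2 (λ m k → m :+ k :- k := m) refl (ι m) (ι k))))) ⟨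
        binom y n * (falling (ι n) k * falling (ι n - ι k) m)
          ≈⟨ *-congˡ (falling-+ (ι n) k m) ⟨
        binom y n * falling (ι n) (k ℕ.+ m)
          ≡⟨ ≡.cong (λ l → binom y n * falling (ι n) l) (ℕ.m+[n∸m]≡n k≤n) ⟩
        binom y n * falling (ι n) n
          ≈⟨ *-congˡ (falling-ι n) ⟩
        binom y n * ι (n !)
          ≈⟨ binom-*! y n ⟩
        falling y n
          ≡⟨ ≡.cong (falling y) (ℕ.m∸n+n≡m k≤n) ⟨
        falling y (m ℕ.+ k)
          ≈⟨ falling-+ y m k ⟩
        falling y m * falling (y - ι m) k
          ≈⟨ *-congˡ (falling-cong k y-m≈y-n+k) ⟩
        falling y m * falling (y - ι n + ι k) k
          ≈⟨ *-cong (binom-*! y m) (binom-*! (y - ι n + ι k) k) ⟨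
        binom y m * ι (m !) * (binom (y - ι n + ι k) k * ι (k !))
          ≈⟨ solve 4 (λ u v w t → u :* v :* (w :* t) := u :* w :* v :* t) refl _ _ _ _ ⟩
        binom y m * binom (y - ι n + ι k) k * ι (m !) * ι (k !)
          ∎))
      where
      m = n ∸ k

      y-m≈y-n+k : y - ι m ≈ y - ι n + ι k
      y-m≈y-n+k = sym (trans (+-congʳ (+-congˡ (-‿cong (ι-∸-+ k≤n))))
        (solve 3 (λ y m k → y :- (m :+ k) :+ k := y :- m) refl y (ι m) (ι k)))

    module _ (n : ℕ) (y#[-n⋯0] : ∀ j → j ≤ n → y # - ι j) (y#[0⋯n-1] : ∀ j → j < n → y # ι j) where

      private
        1/D : Carrier
        1/D = 1# / binom y n [ binom[u,n]#0 y y#[0⋯n-1] ]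

      -- Trinomial revision moves the `k`-dependence of the quotient of binomials into
      -- `binom y (n ∸ k)`, the factor y / (y + k) lowers the upper binomial to `a k`, and (-1)ᵏ =
      -- (-1)ⁿ (-1)ⁿ⁻ᵏ supplies the sign of `b`.
      summand : ∀ k (k≤n : k ≤ n) →
        (- 1#) ^ k
          * binom (ι n) k
          * (binom (y + ι k) k / binom (y - ι n + ι k) k [ binom[u-n+k,k]#0 y y#[0⋯n-1] k≤n ])
          * (y / (y + ι k) [ +ι#0 k (y#[-n⋯0] k k≤n) ])
        ≈ ε n * 1/D * (a k * b (n ∸ k))
      summand k k≤n = begin
        ε k * C * (N * q) * (y * p)
          ≈⟨ *-identityʳ _ ⟨
        ε k * C * (N * q) * (y * p) * 1#
          -- The inserted `1/D * D` provides the `binom y n` that `trinomial-revision` requires.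
          ≈⟨ *-congˡ (/-* 1# (binom[u,n]#0 y y#[0⋯n-1])) ⟨
        ε k * C * (N * q) * (y * p) * (1/D * D)
          ≈⟨ solve 8 (λ e C N q y p d D → e :* C :* (N :* q) :* (y :* p) :* (d :* D) := e :* d :* (C :* D) :* (N :* y) :* (q :* p)) refl (ε k) C N q y p 1/D D ⟩
        ε k * 1/D * (C * D) * (N * y) * (q * p)
          ≈⟨ *-congʳ (*-cong (*-cong (*-congʳ εk≈εnεm) (trinomial-revision k≤n)) (binom-*-shift k)) ⟩
        ε n * ε m * 1/D * (binom y m * Q) * (a k * (y + ι k)) * (q * p)
          ≈⟨ solve 9 (λ e f d β Q a P q p → e :* f :* d :* (β :* Q) :* (a :* P) :* (q :* p) := e :* d :* (a :* (f :* β)) :* (q :* Q) :* (p :* P)) refl (ε n) (ε m) 1/D (binom y m) Q (a k) (y + ι k) q p ⟩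
        ε n * 1/D * (a k * b m) * (q * Q) * (p * (y + ι k))
          ≈⟨ *-cong (*-congˡ (inverseˡ Q#0)) (inverseˡ P#0) ⟩
        ε n * 1/D * (a k * b m) * 1# * 1#
          ≈⟨ trans (*-identityʳ _) (*-identityʳ _) ⟩
        ε n * 1/D * (a k * b m)
          ∎
        where
        m = n ∸ k
        C = binom (ι n) k
        N = binom (y + ι k) k
        Q = binom (y - ι n + ι k) k
        D = binom y n
        Q#0 = binom[u-n+k,k]#0 {n} {k} y y#[0⋯n-1] k≤n
        P#0 = +ι#0 {y} k (y#[-n⋯0] k k≤n)
        q = proj₁ (#⇒invertible Q#0)
        p = proj₁ (#⇒invertible P#0)

        inverseˡ : ∀ {u} (u#0 : u # 0#) → proj₁ (#⇒invertible u#0) * u ≈ 1#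
        inverseˡ u#0 = trans (*-congʳ (sym (*-identityˡ _))) (/-* 1# u#0)

        εk≈εnεm : ε k ≈ ε n * ε m
        εk≈εnεm = begin
          ε k                   ≈⟨ *-identityˡ _ ⟨
          1# * ε k              ≈⟨ *-congʳ (ε²≈1 m) ⟨
          ε m * ε m * ε k       ≈⟨ solve 2 (λ e f → e :* e :* f := e :* f :* e) refl (ε m) (ε k) ⟩
          ε m * ε k * ε m       ≈⟨ *-congʳ (^-homo-* (- 1#) m k) ⟨
          ε (m ℕ.+ k) * ε m     ≡⟨ ≡.cong (λ l → ε l * ε m) (ℕ.m∸n+n≡m k≤n) ⟩
          ε n * ε m             ∎

    -- Both binomials carry the same 1 / n!, so their quotient is that of the falling factorials, to
    -- which the expansion applies.
    1-ratio : ∀ n x (x#[-n⋯-1] : ∀ j → 1 ≤ j → j ≤ n → x # - ι j) (r : ℕ → Carrier) →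
      (∀ i → i < n → (x + ι (suc i)) * r i ≈ 1#) →
      1# - (binom (x - y + ι n) n / binom (x + ι n) n [ binom[u+n,n]#0 x x#[-n⋯-1] ])
      ≈ y * ∑[ i < n ] (ρ n (toℕ i) * r (toℕ i))
    1-ratio n x x#[-n⋯-1] r inv = begin
      1# - binom (x - y + ι n) n / P [ P#0 ]   ≈⟨ +-congˡ (-‿cong (*-cancelʳ P P#0 ratio*P)) ⟩
      1# - (1# - y * S)                        ≈⟨ solve 1 (λ s → :1 :- (:1 :- s) := s) refl (y * S) ⟩
      y * S                                    ∎
      where
      P   = binom (x + ι n) n
      P#0 = binom[u+n,n]#0 {n} x x#[-n⋯-1]
      S   = ∑[ i < n ] (ρ n (toℕ i) * r (toℕ i))

      ratio*P : binom (x - y + ι n) n / P [ P#0 ] * P ≈ (1# - y * S) * P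
      ratio*P = begin
        binom (x - y + ι n) n / P [ P#0 ] * P    ≈⟨ /-* _ P#0 ⟩
        binom (x - y + ι n) n                    ≈⟨ *-congʳ (partialFractions n x r inv) ⟩
        falling (x + ι n) n * (1# - y * S) * _   ≈⟨ solve 3 (λ u v w → u :* v :* w := v :* (u :* w)) refl _ _ _ ⟩
        (1# - y * S) * P                         ∎

theorem8 : ∀ {c ℓ₁ ℓ₂} (F : HeytingField c ℓ₁ ℓ₂) (char0 : CharacteristicZero F) →
  let open HeytingField F
      open Notation F char0
  in
  (n : ℕ) .{{n≢0 : NonZero n}} (x y : Carrier)
  (x#[-n⋯-1] : ∀ j → 1 ≤ j → j ≤ n → x # - ι j)
  (y#[-n⋯0] : ∀ j → j ≤ n → y # - ι j)
  (y#[0⋯n-1] : ∀ j → j < n → y # ι j) →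
  ∑[ i ≤ n ]
    (let k = toℕ i
         k≤n = toℕ≤pred[n] i
     in (- 1#) ^ k
        * binom (ι n) k
        * (binom (y + ι k) k / binom (y - ι n + ι k) k [ binom[u-n+k,k]#0 y y#[0⋯n-1] k≤n ])
        * (y / (y + ι k) [ +ι#0 k (y#[-n⋯0] k k≤n) ])
        * H k x (H-denominators#0 x x#[-n⋯-1] k≤n))
  ≈ ((- 1#) ^ n / ι n [ char0 n ])
    * (1# / binom y n [ binom[u,n]#0 y y#[0⋯n-1] ])
    * (1# - (binom (x - y + ι n) n / binom (x + ι n) n [ binom[u+n,n]#0 x x#[-n⋯-1] ]))
theorem8 F char0 n x y x#[-n⋯-1] y#[-n⋯0] y#[0⋯n-1] = trans
  (sum-cong-≋ {suc n} λ i →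
    *-cong (summand y n y#[-n⋯0] y#[0⋯n-1] (toℕ i) (toℕ≤pred[n] i)) (H≈h (toℕ i) (toℕ≤pred[n] i)))
  (begin
    ∑[ i ≤ n ] (κ * (a y (toℕ i) * b y (n ∸ toℕ i)) * h (toℕ i))
      ≈⟨ sum-cong-≋ {suc n} (λ i → *-assoc κ (a y (toℕ i) * b y (n ∸ toℕ i)) (h (toℕ i))) ⟩
    ∑[ i ≤ n ] (κ * (a y (toℕ i) * b y (n ∸ toℕ i) * h (toℕ i)))
      ≈⟨ ∑-*ˡ (suc n) κ (λ k → a y k * b y (n ∸ k) * h k) ⟨
    κ * W
      -- The convolution determines `ι n * W` only; cancelling `ι n` produces the factor 1 / n of
      -- the right-hand side.
      ≈⟨ *-congˡ (*-cancelʳ (ι n) (char0 n) W*n≈yS/n*n) ⟩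
    κ * (y * S / ι n [ char0 n ])
      ≈⟨ solve 4 (λ e d u v → e :* d :* (u :* v) := e :* v :* d :* u) refl (ε n) _ (y * S) _ ⟩
    (ε n / ι n [ char0 n ]) * (1# / binom y n [ D#0 ]) * (y * S)
      ≈⟨ *-congˡ (1-ratio y n x x#[-n⋯-1] r (proj₂ r,inv)) ⟨
    (ε n / ι n [ char0 n ]) * (1# / binom y n [ D#0 ])
      * (1# - (binom (x - y + ι n) n / binom (x + ι n) n [ binom[u+n,n]#0 x x#[-n⋯-1] ]))
      ∎)
  where
  open HeytingField F
  open Notation F char0
  open HarmonicSums F char0
  open CommutativeRing (HeytingCommutativeRing.commutativeRing heytingCommutativeRing) using (semiring)
  open import Algebra.Properties.Semiring.Sum semiring using (sum-cong-≋)
  open import Relation.Binary.Reasoning.Setoid setoid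
  open IntegerCoefficients (HeytingCommutativeRing.commutativeRing heytingCommutativeRing)

  D#0 = binom[u,n]#0 {n} y y#[0⋯n-1]

  r,inv : ∃ λ (r : ℕ → Carrier) → ∀ i → i < n → (x + ι (suc i)) * r i ≈ 1#
  r,inv = reciprocals n (λ i → x + ι (suc i)) λ i i<n →
    +ι#0 (suc i) (x#[-n⋯-1] (suc i) (s≤s z≤n) i<n)

  r h : ℕ → Carrier
  r = proj₁ r,inv
  h k = ∑[ i < k ] r (toℕ i)

  κ S W : Carrier
  κ = ε n * (1# / binom y n [ D#0 ])
  S = ∑[ i < n ] (ρ y n (toℕ i) * r (toℕ i))
  W = ∑[ i ≤ n ] (a y (toℕ i) * b y (n ∸ toℕ i) * h (toℕ i))

  -- The denominators agree term by term, so uniqueness of inverses suffices.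
  H≈h : ∀ k (k≤n : k ≤ n) → H k x (H-denominators#0 x x#[-n⋯-1] k≤n) ≈ h k
  H≈h k k≤n = sum-cong-≋ {k} λ j → inverse-unique
    (trans (*-comm _ _) (/-* 1# (H-denominators#0 x x#[-n⋯-1] k≤n j)))
    (proj₂ r,inv (toℕ j) (ℕ.<-≤-trans (toℕ<n j) k≤n))

  W*n≈yS/n*n : W * ι n ≈ y * S / ι n [ char0 n ] * ι n
  W*n≈yS/n*n = begin
    W * ι n                           ≈⟨ *-comm _ _ ⟩
    ι n * W                           ≈⟨ convolution y n r h refl (λ k → ∑-last k r) ⟩
    y * S                             ≈⟨ /-* _ (char0 n) ⟨
    y * S / ι n [ char0 n ] * ι n     ∎
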